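{- Let $w$ be a permutation. The graph $G_{D(w)}$ is a forest if and only if $w$ avoids the patterns $3412$, $4312$, $3421$, and $4321$.
   Context: For $w\in S_n$, $D(w)=\{(i,w(j)): 1\le i<j\le n,\ w(i)>w(j)\}$. For a finite set $D$ of cells $(i,j)$ (row $i$, column $j$), $G_D$ is the bipartite graph whose two (disjoint) vertex classes are the set of rows and the set of columns of a rectangle containing $D$, with an edge joining row vertex $i$ and column vertex $j$ if and only if $(i,j)\in D$. A permutation $w$ contains $v\in S_m$ as a pattern if there are $i_1<\cdots<i_m$ such that $w(i_1)\cdots w(i_m)$ is in the same relative order as $v(1)\cdots v(m)$; otherwise $w$ avoids $v$. -}

module Defs where

open import Data.Empty using (⊥)
open import Data.Fin.Base as Fin using (Fin; suc; toℕ; fromℕ; inject₁)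
open import Data.Fin.Patterns using (0F; 1F; 2F; 3F)
open import Data.Fin.Permutation using (Permutation′; permutation; _⟨$⟩ʳ_)
open import Data.Fin.Properties as Fin using (all?)
open import Data.Nat.Base as ℕ using (ℕ)
open import Data.Product.Base using (Σ-syntax; _×_; _,_)
open import Data.Sum.Base using (_⊎_; inj₁; inj₂)
open import Data.Vec.Base using (Vec; _∷_; []; lookup)
open import Function.Bundles using (_⇔_)
open import Function.Definitions using (Injective)
open import Relation.Binary.Core using (Rel; _Preserves_⟶_)
open import Relation.Binary.Definitions using (Symmetric; Irreflexive)
open import Relation.Binary.PropositionalEquality.Core using (_≡_)
open import Relation.Nullary.Decidable using (True; toWitness)
open import Relation.Nullary.Negation using (¬_)
open import Relation.Unary using (Pred; _∈_)
open import Level using (0ℓ)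

record Graph : Set₁ where
  field
    Vertex  : Set
    Adj     : Rel Vertex 0ℓ
    symm    : Symmetric Adj
    irrefl  : Irreflexive _≡_ Adj

-- A cycle on 3 + k distinct vertices, listed in cyclic order.
record Cycle (G : Graph) : Set where
  open Graph G
  field
    k        : ℕ
    vertex   : Fin (3 ℕ.+ k) → Vertex
    distinct : Injective _≡_ _≡_ vertex
    step     : ∀ (i : Fin (2 ℕ.+ k)) → Adj (vertex (inject₁ i)) (vertex (suc i))
    close    : Adj (vertex (fromℕ (2 ℕ.+ k))) (vertex 0F)

IsForest : Graph → Set
IsForest G = ¬ Cycle G

-- Rows, columns, positions and values are all numbered from 0, so each is
-- one less than in the usual 1-based convention.  Rows are numbered downwards
-- and a cell is a pair (row , column).
Cell : Set
Cell = ℕ × ℕ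

-- The rectangle with rows 0, …, p - 1 and columns 0, …, q - 1.
Rectangle : ℕ → ℕ → Pred Cell 0ℓ
Rectangle p q (i , j) = i ℕ.< p × j ℕ.< q

-- inj₁ tags the row vertices and inj₂ the column vertices.
cellAdj : (p q : ℕ) → Pred Cell 0ℓ → Rel (Fin p ⊎ Fin q) 0ℓ
cellAdj p q D (inj₁ i) (inj₂ j) = (toℕ i , toℕ j) ∈ D
cellAdj p q D (inj₂ j) (inj₁ i) = (toℕ i , toℕ j) ∈ D
cellAdj p q D (inj₁ _) (inj₁ _) = ⊥
cellAdj p q D (inj₂ _) (inj₂ _) = ⊥

private
  cellAdj-sym : ∀ p q D → Symmetric (cellAdj p q D)
  cellAdj-sym p q D {inj₁ _} {inj₂ _} d = d
  cellAdj-sym p q D {inj₂ _} {inj₁ _} d = d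

  cellAdj-irrefl : ∀ p q D → Irreflexive _≡_ (cellAdj p q D)
  cellAdj-irrefl p q D {inj₁ _} {inj₂ _} ()
  cellAdj-irrefl p q D {inj₂ _} {inj₁ _} ()

-- The graph G_D drawn on the rows and columns of Rectangle p q, which is
-- meant to contain D.
cellGraph : (p q : ℕ) → Pred Cell 0ℓ → Graph
cellGraph p q D = record
  { Vertex = Fin p ⊎ Fin q
  ; Adj    = cellAdj p q D
  ; symm   = λ {x} {y} → cellAdj-sym p q D {x} {y}
  ; irrefl = λ {x} {y} → cellAdj-irrefl p q D {x} {y}
  }

-- D(w) = { (i , w(j)) : i < j , w(i) > w(j) }.
diagram : {n : ℕ} → Permutation′ n → Pred Cell 0ℓ
diagram {n} w (r , c) =
  Σ[ i ∈ Fin n ] Σ[ j ∈ Fin n ]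
    i Fin.< j × (w ⟨$⟩ʳ i) Fin.> (w ⟨$⟩ʳ j) ×
    r ≡ toℕ i × c ≡ toℕ (w ⟨$⟩ʳ j)

Contains : {n m : ℕ} → Permutation′ n → Permutation′ m → Set
Contains {n} {m} w v =
  Σ[ pos ∈ (Fin m → Fin n) ]
    pos Preserves Fin._<_ ⟶ Fin._<_ ×
    (∀ a b → (w ⟨$⟩ʳ pos a) Fin.< (w ⟨$⟩ʳ pos b) ⇔ (v ⟨$⟩ʳ a) Fin.< (v ⟨$⟩ʳ b))

Avoids : {n m : ℕ} → Permutation′ n → Permutation′ m → Set
Avoids w v = ¬ Contains w v

-- The permutation whose one-line notation is xs; ys is that of its inverse.
oneLine : {m : ℕ} (xs ys : Vec (Fin m) m) →
          {True (all? λ i → lookup xs (lookup ys i) Fin.≟ i)} →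
          {True (all? λ i → lookup ys (lookup xs i) Fin.≟ i)} →
          Permutation′ m
oneLine xs ys {l} {r} = permutation (lookup xs) (lookup ys) (toWitness l) (toWitness r)

p3412 p4312 p3421 p4321 : Permutation′ 4
p3412 = oneLine (2F ∷ 3F ∷ 0F ∷ 1F ∷ []) (2F ∷ 3F ∷ 0F ∷ 1F ∷ [])
p4312 = oneLine (3F ∷ 2F ∷ 0F ∷ 1F ∷ []) (2F ∷ 3F ∷ 1F ∷ 0F ∷ [])
p3421 = oneLine (2F ∷ 3F ∷ 1F ∷ 0F ∷ []) (3F ∷ 2F ∷ 0F ∷ 1F ∷ [])
p4321 = oneLine (3F ∷ 2F ∷ 1F ∷ 0F ∷ []) (3F ∷ 2F ∷ 1F ∷ 0F ∷ [])

{-# OPTIONS --safe #-}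

-- Index columns by the position of their value, so that row i is joined to
-- column j exactly when (i , j) is an inversion.  A 4-cycle of the graph is
-- then two positions followed by two positions carrying smaller values, i.e.
-- an occurrence of one of the four patterns.  Any cycle yields a 4-cycle: pick
-- a row i of it that precedes both rows at distance two along the cycle, and
-- let j < j′ be the two columns next to i on the cycle and i′ > i the other row
-- next to j.  If w(i) < w(i′), then i′ is joined to j′ as well; otherwise i is
-- joined to both columns next to i′.
module Submission where

open import Defs
open import Data.Fin.Base using (Fin; zero; suc; toℕ; fromℕ; fromℕ<; inject₁; _<_; _>_)
open import Data.Fin.Induction using (<-wellFounded)
open import Data.Fin.Patterns using (0F; 1F; 2F; 3F)
open import Data.Fin.Permutation using (Permutation′; _⟨$⟩ʳ_; _⟨$⟩ˡ_; inverseˡ)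
open import Data.Fin.Properties
  using (toℕ-injective; toℕ-fromℕ<; toℕ-inject₁; <-cmp; <-trans; <-irrefl; <-asym)
open import Data.Fin.Relation.Unary.Top using (view; ‵fromℕ; ‵inject₁)
open import Data.Nat.Base as ℕ using (ℕ; z≤n; s≤s)
import Data.Nat.Properties as ℕ
open import Data.Product.Base using (Σ-syntax; ∃-syntax; _×_; _,_; proj₁; proj₂)
open import Data.Sum.Base using (_⊎_; inj₁; inj₂; [_,_])
open import Data.Sum.Properties using (inj₁-injective; inj₂-injective)
open import Data.Vec.Base using (_∷_; []; lookup)
open import Function.Base using (_∘_)
open import Function.Bundles using (_⇔_; mk⇔; Equivalence)
open import Induction.WellFounded using (Acc; acc)
open import Relation.Binary.Core using (_Preserves_⟶_)
open import Relation.Binary.Definitions using (tri<; tri≈; tri>)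
open import Relation.Binary.PropositionalEquality
  using (_≡_; _≢_; refl; sym; trans; cong; subst₂)
open import Relation.Nullary.Negation using (contradiction)
open import Relation.Unary using (_⊆_; _∈_)

-- Order isomorphism from consecutive comparisons

consecutive⇒monotone : ∀ {m n} (f : Fin (ℕ.suc m) → Fin n) →
  (∀ i → f (inject₁ i) < f (suc i)) → f Preserves _<_ ⟶ _<_
consecutive⇒monotone f step {zero}  {suc zero}    _ = step zero
consecutive⇒monotone {ℕ.suc m} f step {zero}  {suc (suc j)} _ =
  <-trans (step zero) (consecutive⇒monotone (f ∘ suc) (step ∘ suc) {zero} {suc j} (s≤s z≤n))
consecutive⇒monotone {ℕ.suc m} f step {suc i} {suc j} (s≤s i<j) =
  consecutive⇒monotone (f ∘ suc) (step ∘ suc) i<j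

monotone⇒reflecting : ∀ {m n} (f : Fin m → Fin n) → f Preserves _<_ ⟶ _<_ →
  ∀ {x y} → f x < f y → x < y
monotone⇒reflecting f mono {x} {y} fx<fy with <-cmp x y
... | tri< x<y _ _ = x<y
... | tri≈ _ refl _ = contradiction fx<fy (<-irrefl refl)
... | tri> _ _ y<x = contradiction (mono y<x) (<-asym fx<fy)

-- Reading positions in the order of the values of `v` turns the pattern condition into monotonicity
-- of `val`; a monotone map between finite chains also reflects the order, which gives both
-- directions of the equivalence.
contains : ∀ {m n} (w : Permutation′ n) (v : Permutation′ (ℕ.suc m)) (pos : Fin (ℕ.suc m) → Fin n) →
  (∀ i → pos (inject₁ i) < pos (suc i)) →
  (∀ k → w ⟨$⟩ʳ pos (v ⟨$⟩ˡ inject₁ k) < w ⟨$⟩ʳ pos (v ⟨$⟩ˡ suc k)) →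
  Contains w v
contains {m} {n} w v pos pos-step val-step =
  pos , consecutive⇒monotone pos pos-step , λ a b → mk⇔
    (λ lt → monotone⇒reflecting val val-mono
      (subst₂ _<_ (sym (val∘v a)) (sym (val∘v b)) lt))
    (λ lt → subst₂ _<_ (val∘v a) (val∘v b) (val-mono lt))
  where
  val : Fin (ℕ.suc m) → Fin n
  val k = w ⟨$⟩ʳ pos (v ⟨$⟩ˡ k)

  val-mono : val Preserves _<_ ⟶ _<_
  val-mono = consecutive⇒monotone val val-step

  val∘v : ∀ a → val (v ⟨$⟩ʳ a) ≡ w ⟨$⟩ʳ pos a
  val∘v a = cong (λ x → w ⟨$⟩ʳ pos x) (inverseˡ v)

-- Cyclic neighbours of an index

prev : ∀ {m} → Fin (ℕ.suc m) → Fin (ℕ.suc m)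
prev {m} zero = fromℕ m
prev (suc i)  = inject₁ i

next : ∀ {m} → Fin (ℕ.suc m) → Fin (ℕ.suc m)
next i with view i
... | ‵fromℕ      = zero
... | ‵inject₁ j  = suc j

prev-next : ∀ {m} (i : Fin (ℕ.suc m)) → prev (next i) ≡ i
prev-next i with view i
... | ‵fromℕ      = refl
... | ‵inject₁ _  = refl

prev²≢id : ∀ {k} (i : Fin (3 ℕ.+ k)) → prev (prev i) ≢ i
prev²≢id zero          ()
prev²≢id (suc zero)    ()
-- No wrap-around occurs here: two steps back reach index `toℕ i`, which differs from `2 + toℕ i`;
-- the `{1}` splits off one of the two successors.
prev²≢id (suc (suc i)) eq = ℕ.m≢1+n+m (toℕ i) {1}
  (trans (sym (trans (toℕ-inject₁ (inject₁ i)) (toℕ-inject₁ i))) (cong toℕ eq))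

next²≢id : ∀ {k} (i : Fin (3 ℕ.+ k)) → next (next i) ≢ i
next²≢id i eq = prev²≢id i
  (trans (cong (prev ∘ prev) (sym eq)) (trans (cong prev (prev-next (next i))) (prev-next i)))

next≢prev : ∀ {k} (i : Fin (3 ℕ.+ k)) → next i ≢ prev i
next≢prev i eq = prev²≢id i (trans (cong prev (sym eq)) (prev-next i))

-- Squares of inversions and the four patterns

module _ {n : ℕ} (w : Permutation′ n) where

  Inversion : Fin n → Fin n → Set
  Inversion i j = i < j × (w ⟨$⟩ʳ i) > (w ⟨$⟩ʳ j)

  record Square : Set where
    constructor square
    field
      {a b c d} : Fin n
      a<b : a < b
      c<d : c < d
      ac  : Inversion a c
      ad  : Inversion a d
      bc  : Inversion b c
      bd  : Inversion b d

  w-injective : ∀ {i j} → w ⟨$⟩ʳ i ≡ w ⟨$⟩ʳ j → i ≡ j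
  w-injective eq = trans (sym (inverseˡ w)) (trans (cong (w ⟨$⟩ˡ_) eq) (inverseˡ w))

  values-cmp : ∀ {i j} → i < j → (w ⟨$⟩ʳ i) < (w ⟨$⟩ʳ j) ⊎ (w ⟨$⟩ʳ j) < (w ⟨$⟩ʳ i)
  values-cmp {i} {j} i<j with <-cmp (w ⟨$⟩ʳ i) (w ⟨$⟩ʳ j)
  ... | tri< lt _ _ = inj₁ lt
  ... | tri≈ _ eq _ = contradiction i<j (<-irrefl (w-injective eq))
  ... | tri> _ _ gt = inj₂ gt

  square-columns : ∀ {a b c d} → a < b → c ≢ d →
    Inversion a c → Inversion a d → Inversion b c → Inversion b d → Square
  square-columns {c = c} {d} a<b c≢d ac ad bc bd with <-cmp c d
  ... | tri< c<d _ _ = square a<b c<d ac ad bc bd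
  ... | tri≈ _ eq _  = contradiction eq c≢d
  ... | tri> _ _ d<c = square a<b d<c ad ac bd bc

  -- The inversions force a < b < c < d with both values at a, b above both values at c, d. Only the
  -- order inside each pair is free, and its four outcomes are the four patterns.
  square⇒pattern : Square →
    Contains w p3412 ⊎ Contains w p4312 ⊎ Contains w p3421 ⊎ Contains w p4321
  square⇒pattern (square {a} {b} {c} {d} a<b c<d (_ , wc<wa) (_ , wd<wa) (b<c , wc<wb) (_ , wd<wb))
    with values-cmp a<b | values-cmp c<d
  ... | inj₁ wa<wb | inj₁ wc<wd =
    inj₁ (contains w p3412 (lookup (a ∷ b ∷ c ∷ d ∷ []))
      (λ { 0F → a<b ; 1F → b<c ; 2F → c<d })
      (λ { 0F → wc<wd ; 1F → wd<wa ; 2F → wa<wb }))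
  ... | inj₂ wb<wa | inj₁ wc<wd =
    inj₂ (inj₁ (contains w p4312 (lookup (a ∷ b ∷ c ∷ d ∷ []))
      (λ { 0F → a<b ; 1F → b<c ; 2F → c<d })
      (λ { 0F → wc<wd ; 1F → wd<wb ; 2F → wb<wa })))
  ... | inj₁ wa<wb | inj₂ wd<wc =
    inj₂ (inj₂ (inj₁ (contains w p3421 (lookup (a ∷ b ∷ c ∷ d ∷ []))
      (λ { 0F → a<b ; 1F → b<c ; 2F → c<d })
      (λ { 0F → wd<wc ; 1F → wc<wa ; 2F → wa<wb }))))
  ... | inj₂ wb<wa | inj₂ wd<wc =
    inj₂ (inj₂ (inj₂ (contains w p4321 (lookup (a ∷ b ∷ c ∷ d ∷ []))
      (λ { 0F → a<b ; 1F → b<c ; 2F → c<d })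
      (λ { 0F → wd<wc ; 1F → wc<wb ; 2F → wb<wa }))))

  -- The four inequalities are what the patterns share: each of the last two entries lies below each
  -- of the first two.
  pattern⇒square : (v : Permutation′ 4) →
    (v ⟨$⟩ʳ 2F) < (v ⟨$⟩ʳ 0F) → (v ⟨$⟩ʳ 3F) < (v ⟨$⟩ʳ 0F) →
    (v ⟨$⟩ʳ 2F) < (v ⟨$⟩ʳ 1F) → (v ⟨$⟩ʳ 3F) < (v ⟨$⟩ʳ 1F) →
    Contains w v → Square
  pattern⇒square v v₂<v₀ v₃<v₀ v₂<v₁ v₃<v₁ (pos , mono , same) = square
    (position 0F 1F (s≤s z≤n)) (position 2F 3F (s≤s (s≤s (s≤s z≤n))))
    (position 0F 2F (s≤s z≤n) , value 2F 0F v₂<v₀)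
    (position 0F 3F (s≤s z≤n) , value 3F 0F v₃<v₀)
    (position 1F 2F (s≤s (s≤s z≤n)) , value 2F 1F v₂<v₁)
    (position 1F 3F (s≤s (s≤s z≤n)) , value 3F 1F v₃<v₁)
    where
    value : ∀ a b → (v ⟨$⟩ʳ a) < (v ⟨$⟩ʳ b) → (w ⟨$⟩ʳ pos a) < (w ⟨$⟩ʳ pos b)
    value a b = Equivalence.from (same a b)
    position : ∀ a b → a < b → pos a < pos b
    position a b = mono {a} {b}

  -- Transitivity supplies the missing edge: i′ < j < j′ and w(j′) < w(i) < w(i′) join i′ to j′, or
  -- i < i′ < j″ and w(j″) < w(i′) < w(i) join i to j″. The columns j′ and j″ may coincide.
  half-cycle⇒square : ∀ {i i′ j j′ j″} → i < i′ → j < j′ → j ≢ j″ →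
    Inversion i j → Inversion i j′ → Inversion i′ j → Inversion i′ j″ → Square
  half-cycle⇒square {i} {i′} i<i′ j<j′ j≢j″ ij ij′@(_ , wj′<wi) i′j@(i′<j , _) i′j″@(i′<j″ , wj″<wi′)
    with values-cmp i<i′
  ... | inj₁ wi<wi′ = square i<i′ j<j′ ij ij′ i′j (<-trans i′<j j<j′ , <-trans wj′<wi wi<wi′)
  ... | inj₂ wi′<wi =
    square-columns i<i′ j≢j″ ij (<-trans i<i′ i′<j″ , <-trans wj″<wi′ wi′<wi) i′j i′j″

  -- From a square to a cycle

  module _ (p q : ℕ) where

    square⇒cycle : diagram w ⊆ Rectangle p q → Square → Cycle (cellGraph p q (diagram w))
    square⇒cycle bounded (square {a} {b} {c} {d} a<b c<d ac ad bc bd) = record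
      { k        = 1
      ; vertex   = vertex
      ; distinct = λ {x} {y} → distinct x y
      ; step     = λ { 0F → cell a<p c<q ac ; 1F → cell b<p c<q bc ; 2F → cell b<p d<q bd }
      ; close    = cell a<p d<q ad
      }
      where
      inDiagram : ∀ {i j} → Inversion i j → (toℕ i , toℕ (w ⟨$⟩ʳ j)) ∈ diagram w
      inDiagram {i} {j} (i<j , wj<wi) = i , j , i<j , wj<wi , refl , refl

      -- Each row and column of the square carries a cell of the diagram, so it lies in the
      -- rectangle.
      a<p : toℕ a ℕ.< p
      a<p = proj₁ (bounded (inDiagram ac))
      b<p : toℕ b ℕ.< p
      b<p = proj₁ (bounded (inDiagram bc))
      c<q : toℕ (w ⟨$⟩ʳ c) ℕ.< q
      c<q = proj₂ (bounded (inDiagram ac))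
      d<q : toℕ (w ⟨$⟩ʳ d) ℕ.< q
      d<q = proj₂ (bounded (inDiagram ad))

      cell : ∀ {i j} (i<p : toℕ i ℕ.< p) (j<q : toℕ (w ⟨$⟩ʳ j) ℕ.< q) → Inversion i j →
        (toℕ (fromℕ< i<p) , toℕ (fromℕ< j<q)) ∈ diagram w
      cell {i} {j} i<p j<q (i<j , wj<wi) = i , j , i<j , wj<wi , toℕ-fromℕ< i<p , toℕ-fromℕ< j<q

      vertex : Fin 4 → Fin p ⊎ Fin q
      vertex = lookup (inj₁ (fromℕ< a<p) ∷ inj₂ (fromℕ< c<q) ∷ inj₁ (fromℕ< b<p) ∷ inj₂ (fromℕ< d<q) ∷ [])

      fromℕ<-injective′ : ∀ {l r s} (r<l : r ℕ.< l) (s<l : s ℕ.< l) → fromℕ< r<l ≡ fromℕ< s<l → r ≡ s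
      fromℕ<-injective′ r<l s<l eq =
        trans (sym (toℕ-fromℕ< r<l)) (trans (cong toℕ eq) (toℕ-fromℕ< s<l))

      a≢b : inj₁ {B = Fin q} (fromℕ< a<p) ≢ inj₁ (fromℕ< b<p)
      a≢b eq = ℕ.<⇒≢ a<b (fromℕ<-injective′ a<p b<p (inj₁-injective eq))

      c≢d : inj₂ {A = Fin p} (fromℕ< c<q) ≢ inj₂ (fromℕ< d<q)
      c≢d eq = <-irrefl
        (w-injective (toℕ-injective (fromℕ<-injective′ c<q d<q (inj₂-injective eq)))) c<d

      distinct : ∀ x y → vertex x ≡ vertex y → x ≡ y
      distinct 0F 0F _  = refl
      distinct 0F 1F ()
      distinct 0F 2F eq = contradiction eq a≢b
      distinct 0F 3F ()
      distinct 1F 0F ()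
      distinct 1F 1F _  = refl
      distinct 1F 2F ()
      distinct 1F 3F eq = contradiction eq c≢d
      distinct 2F 0F eq = contradiction (sym eq) a≢b
      distinct 2F 1F ()
      distinct 2F 2F _  = refl
      distinct 2F 3F ()
      distinct 3F 0F ()
      distinct 3F 1F eq = contradiction (sym eq) c≢d
      distinct 3F 2F ()
      distinct 3F 3F _  = refl

    -- From a cycle to a square

    module _ (cycle : Cycle (cellGraph p q (diagram w))) where
      open Graph (cellGraph p q (diagram w)) using (Adj; symm)
      open Cycle cycle

      Index : Set
      Index = Fin (3 ℕ.+ k)

      -- Vertices are bounded by `p` and `q`, positions by `n`, so they are matched through `toℕ`. A
      -- column is named by the position of its value.
      RowAt ColumnAt : Index → Fin n → Set
      RowAt    t i = Σ[ r ∈ Fin p ] vertex t ≡ inj₁ r × toℕ r ≡ toℕ i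
      ColumnAt t j = Σ[ c ∈ Fin q ] vertex t ≡ inj₂ c × toℕ c ≡ toℕ (w ⟨$⟩ʳ j)

      rowAt-unique : ∀ {t t′ i} → RowAt t i → RowAt t′ i → t ≡ t′
      rowAt-unique (r , t≡r , r≡i) (r′ , t′≡r′ , r′≡i) = distinct
        (trans t≡r (trans (cong inj₁ (toℕ-injective (trans r≡i (sym r′≡i)))) (sym t′≡r′)))

      columnAt-unique : ∀ {t t′ j} → ColumnAt t j → ColumnAt t′ j → t ≡ t′
      columnAt-unique (c , t≡c , c≡j) (c′ , t′≡c′ , c′≡j) = distinct
        (trans t≡c (trans (cong inj₂ (toℕ-injective (trans c≡j (sym c′≡j)))) (sym t′≡c′)))

      row-neighbour : ∀ {t t′ i} → RowAt t i → Adj (vertex t) (vertex t′) →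
        ∃[ j ] ColumnAt t′ j × Inversion i j
      row-neighbour {t} {t′} (r , t≡r , r≡i) adj with vertex t | vertex t′ | t≡r | adj
      ... | _ | inj₂ c | refl | (i₀ , j , i₀<j , wj<wi₀ , r≡i₀ , c≡wj)
        -- The cell comes with its own position `i₀`, which equals `i` because both number the same
        -- row.
        with toℕ-injective (trans (sym r≡i) r≡i₀)
      ... | refl = j , (c , refl , c≡wj) , i₀<j , wj<wi₀

      column-neighbour : ∀ {t t′ j} → ColumnAt t j → Adj (vertex t) (vertex t′) →
        ∃[ i ] RowAt t′ i × Inversion i j
      column-neighbour {t} {t′} (c , t≡c , c≡wj) adj with vertex t | vertex t′ | t≡c | adj
      ... | _ | inj₁ r | refl | (i , j₀ , i<j₀ , wj₀<wi , r≡i , c≡wj₀)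
        with w-injective (toℕ-injective (trans (sym c≡wj) c≡wj₀))
      ... | refl = i , (r , refl , r≡i) , i<j₀ , wj₀<wi

      some-row : ∃[ t ] ∃[ i ] RowAt t i
      some-row with vertex 0F in eq₀ | vertex 1F in eq₁ | step 0F
      ... | inj₁ r | inj₂ _ | (i , _ , _ , _ , r≡i , _) = 0F , i , r , eq₀ , r≡i
      ... | inj₂ _ | inj₁ r | (i , _ , _ , _ , r≡i , _) = 1F , i , r , eq₁ , r≡i

      adj-prev : ∀ t → Adj (vertex t) (vertex (prev t))
      adj-prev zero    = symm {vertex (fromℕ (2 ℕ.+ k))} {vertex 0F} close
      adj-prev (suc t) = symm {vertex (inject₁ t)} {vertex (suc t)} (step t)

      adj-next : ∀ t → Adj (vertex t) (vertex (next t))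
      adj-next t with view t
      ... | ‵fromℕ     = close
      ... | ‵inject₁ i = step i

      -- The path i, j, i′, j″ along the cycle in either direction; `t₁` and `t₂` locate j and i′.
      record Arm (t₁ : Index) (i : Fin n) : Set where
        constructor arm
        field
          {t₂}      : Index
          {i′ j j″} : Fin n
          column    : ColumnAt t₁ j
          row       : RowAt t₂ i′
          i≢i′      : i ≢ i′
          j≢j″      : j ≢ j″
          ij        : Inversion i j
          i′j       : Inversion i′ j
          i′j″      : Inversion i′ j″

      -- Two steps of `s` never return to their start, so distinctness of the cycle's vertices
      -- separates the two rows and the two columns.
      walk : (s : Index → Index) → (∀ t → Adj (vertex t) (vertex (s t))) → (∀ t → s (s t) ≢ t) →
        ∀ {t i} → RowAt t i → Arm (s t) i
      walk s adj s²≢id {t} row₀ with row-neighbour row₀ (adj t)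
      ... | j , column₁ , ij with column-neighbour column₁ (adj (s t))
      ... | i′ , row₂ , i′j with row-neighbour row₂ (adj (s (s t)))
      ... | j″ , column₃ , i′j″ = arm column₁ row₂
        (λ { refl → s²≢id t (rowAt-unique row₂ row₀) })
        (λ { refl → s²≢id (s t) (columnAt-unique column₃ column₁) })
        ij i′j i′j″

      -- While a row at distance two is smaller, move to it; well-foundedness ends this at a row
      -- preceding both.
      descend : ∀ {t i} → Acc _<_ i → RowAt t i → Square
      descend {t} {i} (acc rec) row₀
        with walk next adj-next next²≢id row₀ | walk prev adj-prev prev²≢id row₀
      ... | arm {i′ = i₁} {j₁} column₁ row₁ i≢i₁ j₁≢ ij₁ i₁j₁ i₁j₁″
          | arm {i′ = i₂} {j₂} column₂ row₂ i≢i₂ j₂≢ ij₂ i₂j₂ i₂j₂″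
        with <-cmp i i₁ | <-cmp i i₂ | <-cmp j₁ j₂
      ... | tri> _ _ i₁<i | _              | _ = descend (rec i₁<i) row₁
      ... | tri≈ _ i≡i₁ _ | _              | _ = contradiction i≡i₁ i≢i₁
      ... | tri< _ _ _    | tri> _ _ i₂<i  | _ = descend (rec i₂<i) row₂
      ... | tri< _ _ _    | tri≈ _ i≡i₂ _  | _ = contradiction i≡i₂ i≢i₂
      -- The arm through the smaller column gives i′ and j″; the other arm only contributes its
      -- column as j′.
      ... | tri< i<i₁ _ _ | tri< _ _ _     | tri< j₁<j₂ _ _ =
        half-cycle⇒square i<i₁ j₁<j₂ j₁≢ ij₁ ij₂ i₁j₁ i₁j₁″
      ... | tri< _ _ _    | tri< i<i₂ _ _  | tri> _ _ j₂<j₁ =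
        half-cycle⇒square i<i₂ j₂<j₁ j₂≢ ij₂ ij₁ i₂j₂ i₂j₂″
      ... | tri< _ _ _    | tri< _ _ _     | tri≈ _ refl _ =
        contradiction (columnAt-unique column₁ column₂) (next≢prev t)

      cycle⇒square : Square
      cycle⇒square with some-row
      ... | _ , i , row = descend (<-wellFounded i) row

theorem6p9 : (n : ℕ) (w : Permutation′ n) (p q : ℕ) → diagram w ⊆ Rectangle p q →
    IsForest (cellGraph p q (diagram w)) ⇔ (Avoids w p3412 × Avoids w p4312 × Avoids w p3421 × Avoids w p4321)
theorem6p9 n w p q bounded = mk⇔
  (λ forest →
    let noSquare = forest ∘ square⇒cycle w p q bounded in
    -- The numerals compare entries of the pattern: `s≤s z≤n` when the smaller one is 0,
    -- `s≤s (s≤s z≤n)` when it is 1.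
    noSquare ∘ pattern⇒square w p3412 (s≤s z≤n) (s≤s (s≤s z≤n)) (s≤s z≤n) (s≤s (s≤s z≤n)) ,
    noSquare ∘ pattern⇒square w p4312 (s≤s z≤n) (s≤s (s≤s z≤n)) (s≤s z≤n) (s≤s (s≤s z≤n)) ,
    noSquare ∘ pattern⇒square w p3421 (s≤s (s≤s z≤n)) (s≤s z≤n) (s≤s (s≤s z≤n)) (s≤s z≤n) ,
    noSquare ∘ pattern⇒square w p4321 (s≤s (s≤s z≤n)) (s≤s z≤n) (s≤s (s≤s z≤n)) (s≤s z≤n))
  (λ (no3412 , no4312 , no3421 , no4321) cycle →
    [ no3412 , [ no4312 , [ no3421 , no4321 ] ] ] (square⇒pattern w (cycle⇒square w p q cycle)))
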